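{- For a UC family $\mathcal{A}$ with $U(\mathcal{A})=[n]$ and $\emptyset\in\mathcal{A}$, write $\mathcal{B}^{(j)}=\mathcal{P}([n]\setminus\{j\})\uplus\mathcal{A}$ for $j\in[n]$. The existence of $y\in\mathbb{R}_{\ge0}^n$ with $\sum_{i\in[n]}y_i\le1$ and $$\sum_{i\in[n]}y_i|\mathcal{B}^{(j)}_i|=|\mathcal{B}^{(j)}|/2\quad\text{for all }j\in[n]$$ does not necessarily imply that $P^{\mathcal{A}}$ is nonempty. That is, there exist $n\ge1$ and a UC family $\mathcal{A}$ with $U(\mathcal{A})=[n]$ and $\emptyset\in\mathcal{A}$ for which such a $y$ exists but $P^{\mathcal{A}}=\emptyset$.
   Context: A UC (union-closed) family is a nonempty finite family $\mathcal{F}$ of distinct finite sets such that $A\cup B\in\mathcal{F}$ for all $A,B\in\mathcal{F}$. $[n]=\{1,\dots,n\}$, $\mathcal{P}([n])$ is its power set, $U(\mathcal{F})$ is the union of all sets in $\mathcal{F}$, $\mathcal{F}_i=\{F\in\mathcal{F} : i\in F\}$, and $\mathcal{A}\uplus\mathcal{B}=\{A\cup B : A\in\mathcal{A},B\in\mathcal{B}\}$. $P^{\mathcal{A}}$ is the polyhedron of all $y\in\mathbb{R}^n$ with $y_i\ge0$ for all $i\in[n]$, $\sum_{i\in[n]}y_i=1$, and $\sum_{i\in[n]}y_i|\mathcal{B}_i|\ge|\mathcal{B}|/2$ for every UC family $\mathcal{B}\subseteq\mathcal{P}([n])$ with $\mathcal{B}\uplus\mathcal{A}=\mathcal{B}$.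 -}

module Defs where

open import Algebra.Bundles using (RawMonoid; CommutativeMonoid)
import Algebra.Definitions.RawMonoid as RawMonoidDefinitions
open import Data.Bool.Properties using () renaming (_≟_ to _≟ᵇ_)
open import Data.Fin using (Fin)
open import Data.Fin.Subset using (Subset; inside; outside; _∪_)
open import Data.Fin.Subset.Properties using (_∈?_)
open import Data.Integer using (+_)
open import Data.List using (List; []; _∷_; map; _++_; length; filter; deduplicate; cartesianProductWith)
open import Data.List.Membership.Propositional using () renaming (_∈_ to _∈ˡ_)
open import Data.List.Membership.Propositional.Properties using (∈-map⁻)
open import Data.List.Relation.Binary.BagAndSetEquality using (_∼[_]_; set)
open import Data.List.Relation.Unary.All using ([])
open import Data.List.Relation.Unary.AllPairs using ([]; _∷_)
open import Data.List.Relation.Unary.Unique.Propositional using (Unique)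
import Data.List.Relation.Unary.Unique.Propositional.Properties as Unique
import Data.List.Relation.Unary.Unique.DecPropositional.Properties as DecUnique
open import Data.Nat using (ℕ; _⊔_) renaming (_≤_ to _≤ⁿ_)
open import Data.Nat.Properties using (m⊔n≤o⇒m≤o; m⊔n≤o⇒n≤o)
open import Data.Product using (∃; _×_; _,_)
open import Data.Rational using (ℚ; 0ℚ; 1ℚ; ½; ∣_∣; _+_; _-_; _*_; _≤_; _<_; _/_; -_)
open import Data.Rational.Properties
  using (<⇒≤; module ≤-Reasoning; +-inverseʳ; ∣p+q∣≤∣p∣+∣q∣; +-mono-≤;
         *-distribˡ-+; *-identityʳ; *-zeroʳ; *-monoʳ-<-pos; *-comm; +-0-commutativeMonoid;
         neg-distrib-+)
open import Data.Vec using ([]; _∷_)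
open import Data.Vec.Functional using (Vector)
open import Data.Vec.Properties using (≡-dec; ∷-injectiveʳ)
open import Level using (0ℓ)
open import Relation.Binary using (DecidableEquality)
open import Relation.Binary.PropositionalEquality
  using (_≡_; _≢_; refl; sym; trans; cong; cong₂; subst)
open import Relation.Nullary using (¬_)

open import Algebra.Properties.CommutativeSemigroup
  (CommutativeMonoid.commutativeSemigroup +-0-commutativeMonoid) using (interchange)

-- Real numbers as Cauchy sequences of rationals.  Convergence to a common
-- limit is the setoid equality _≈ᴿ_; x ≤ᴿ y says lim x ≤ lim y.

IsCauchy : (ℕ → ℚ) → Set
IsCauchy s = ∀ ε → 0ℚ < ε → ∃ λ N → ∀ m n → N ≤ⁿ m → N ≤ⁿ n → ∣ s m - s n ∣ ≤ ε

record ℝ : Set where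
  constructor mkℝ
  field
    seq      : ℕ → ℚ
    isCauchy : IsCauchy seq

open ℝ public

infix 4 _≈ᴿ_ _≤ᴿ_ _≥ᴿ_

_≈ᴿ_ : ℝ → ℝ → Set
x ≈ᴿ y = ∀ ε → 0ℚ < ε → ∃ λ N → ∀ n → N ≤ⁿ n → ∣ seq x n - seq y n ∣ ≤ ε

_≤ᴿ_ : ℝ → ℝ → Set
x ≤ᴿ y = ∀ ε → 0ℚ < ε → ∃ λ N → ∀ n → N ≤ⁿ n → seq x n ≤ seq y n + ε

_≥ᴿ_ : ℝ → ℝ → Set
x ≥ᴿ y = y ≤ᴿ x

fromℚ : ℚ → ℝ
fromℚ q = mkℝ (λ _ → q) λ ε 0<ε → 0 , λ _ _ _ _ →
  subst (_≤ ε) (sym (cong ∣_∣ (+-inverseʳ q))) (<⇒≤ 0<ε)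

0ᴿ 1ᴿ : ℝ
0ᴿ = fromℚ 0ℚ
1ᴿ = fromℚ 1ℚ

private
  half-pos : ∀ {ε} → 0ℚ < ε → 0ℚ < ½ * ε
  half-pos {ε} 0<ε = subst (_< ½ * ε) (*-zeroʳ ½) (*-monoʳ-<-pos ½ 0<ε)

  half+half : ∀ ε → ½ * ε + ½ * ε ≡ ε
  half+half ε = trans (cong₂ _+_ (*-comm ½ ε) (*-comm ½ ε))
               (trans (sym (*-distribˡ-+ ε ½ ½)) (*-identityʳ ε))

  +-sub-interchange : ∀ a b c d → (a + b) - (c + d) ≡ (a - c) + (b - d)
  +-sub-interchange a b c d =
    trans (cong (λ z → (a + b) + z) (neg-distrib-+ c d)) (interchange a b (- c) (- d))

infixl 6 _+ᴿ_

_+ᴿ_ : ℝ → ℝ → ℝ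
seq (x +ᴿ y) n = seq x n + seq y n
isCauchy (x +ᴿ y) ε 0<ε
  with M , p ← isCauchy x (½ * ε) (half-pos 0<ε)
     | N , q ← isCauchy y (½ * ε) (half-pos 0<ε)
  = M ⊔ N , λ m n le le′ → begin
    ∣ (seq x m + seq y m) - (seq x n + seq y n) ∣
      ≡⟨ cong ∣_∣ (+-sub-interchange (seq x m) (seq y m) (seq x n) (seq y n)) ⟩
    ∣ (seq x m - seq x n) + (seq y m - seq y n) ∣
      ≤⟨ ∣p+q∣≤∣p∣+∣q∣ (seq x m - seq x n) (seq y m - seq y n) ⟩
    ∣ seq x m - seq x n ∣ + ∣ seq y m - seq y n ∣
      ≤⟨ +-mono-≤ (p m n (m⊔n≤o⇒m≤o M N le) (m⊔n≤o⇒m≤o M N le′))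
                  (q m n (m⊔n≤o⇒n≤o M N le) (m⊔n≤o⇒n≤o M N le′)) ⟩
    ½ * ε + ½ * ε
      ≡⟨ half+half ε ⟩
    ε ∎
  where open ≤-Reasoning

+ᴿ-rawMonoid : RawMonoid 0ℓ 0ℓ
+ᴿ-rawMonoid = record { Carrier = ℝ ; _≈_ = _≈ᴿ_ ; _∙_ = _+ᴿ_ ; ε = 0ᴿ }

-- k · x is the product of the natural number k with the real x.
open RawMonoidDefinitions +ᴿ-rawMonoid public using (sum) renaming (_×_ to _·_)

-- Finite families of distinct subsets of an n-element set; Fin n plays the
-- role of [n].

record Family (n : ℕ) : Set where
  constructor mkFamily
  field
    sets     : List (Subset n)
    distinct : Unique sets

open Family public

infix 4 _≟ˢ_ _∈ᶠ_ _≐_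

_≟ˢ_ : ∀ {n} → DecidableEquality (Subset n)
_≟ˢ_ = ≡-dec _≟ᵇ_

_∈ᶠ_ : ∀ {n} → Subset n → Family n → Set
S ∈ᶠ F = S ∈ˡ sets F

_≐_ : ∀ {n} → Family n → Family n → Set
F ≐ G = sets F ∼[ set ] sets G

card : ∀ {n} → Family n → ℕ
card F = length (sets F)

infixl 8 _at_

-- F at i is the subfamily F_i of the members containing i.
_at_ : ∀ {n} → Family n → Fin n → Family n
sets     (F at i) = filter (i ∈?_) (sets F)
distinct (F at i) = Unique.filter⁺ (i ∈?_) (distinct F)

infixr 6 _⊎_

_⊎_ : ∀ {n} → Family n → Family n → Family n
sets     (F ⊎ G) = deduplicate _≟ˢ_ (cartesianProductWith _∪_ (sets F) (sets G))
distinct (F ⊎ G) = DecUnique.deduplicate-! _≟ˢ_ (cartesianProductWith _∪_ (sets F) (sets G))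

subsets : ∀ {n} → Subset n → List (Subset n)
subsets []            = [] ∷ []
subsets (outside ∷ S) = map (outside ∷_) (subsets S)
subsets (inside  ∷ S) = map (outside ∷_) (subsets S) ++ map (inside ∷_) (subsets S)

subsets-unique : ∀ {n} (S : Subset n) → Unique (subsets S)
subsets-unique []            = [] ∷ []
subsets-unique (outside ∷ S) = Unique.map⁺ ∷-injectiveʳ (subsets-unique S)
subsets-unique (inside  ∷ S) =
  Unique.++⁺ (Unique.map⁺ ∷-injectiveʳ (subsets-unique S))
             (Unique.map⁺ ∷-injectiveʳ (subsets-unique S))
             λ (p , q) → outside≢inside (∈-map⁻ (outside ∷_) p) (∈-map⁻ (inside ∷_) q)
  where
  outside≢inside : ∀ {T} → (∃ λ U → U ∈ˡ subsets S × T ≡ outside ∷ U) →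
                   ¬ (∃ λ U → U ∈ˡ subsets S × T ≡ inside ∷ U)
  outside≢inside (_ , _ , refl) (_ , _ , ())

𝒫 : ∀ {n} → Subset n → Family n
𝒫 S = mkFamily (subsets S) (subsets-unique S)

record IsUC {n} (F : Family n) : Set where
  field
    nonempty : sets F ≢ []
    closed   : ∀ {S T} → S ∈ᶠ F → T ∈ᶠ F → S ∪ T ∈ᶠ F

weight : ∀ {n} → Vector ℝ n → Family n → ℝ
weight y F = sum λ i → card (F at i) · y i

half-card : ∀ {n} → Family n → ℝ
half-card F = fromℚ (+ card F / 2)

record Polyhedron {n} (A : Family n) (y : Vector ℝ n) : Set where
  field
    nonneg : ∀ i → y i ≥ᴿ 0ᴿ
    total  : sum y ≈ᴿ 1ᴿ
    heavy  : ∀ (B : Family n) → IsUC B → B ⊎ A ≐ B → weight y B ≥ᴿ half-card B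

{-# OPTIONS --safe #-}
module Submission where

-- Let 𝒜 be generated by ∅, 012, 0123, 01245, 0345, 1345, 2345.  The six
-- equations have a unique solution; it is nonnegative with total 2137/2138, but
-- they do not see the family 𝒢 = (𝒫(0123) ⊎ {∅, 345}) ⊎ 𝒜 of 25 sets.  Taking
-- 𝓑⁽⁰⁾, 𝓑⁽¹⁾, 𝓑⁽²⁾, 𝓑⁽³⁾, 𝒢 with multiplicities 7, 7, 7, 8, 16 gives
-- 3·7·43 + 8·42 + 16·25 = 1639 sets, of which each element lies in exactly
-- 819 < 1639/2, so the inequalities of P^𝒜 for these five families contradict
-- Σ yᵢ = 1.

open import Defs
open import Algebra.Bundles using (CommutativeMonoid)
import Algebra.Properties.CommutativeMonoid.Mult as CommutativeMonoidMult
import Algebra.Properties.CommutativeMonoid.Sum as CommutativeMonoidSum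
open import Algebra.Properties.AbelianGroup using (xyx⁻¹≈y)
open import Algebra.Properties.CommutativeSemigroup using (interchange)
open import Algebra.Properties.Group using (⁻¹-anti-homo-//)
import Algebra.Properties.Monoid.Sum as MonoidSum
open import Data.Fin using (Fin; zero; suc)
open import Data.Fin.Properties using (all?)
open import Data.Fin.Patterns using (0F; 1F; 2F; 3F; 4F; 5F)
open import Data.Fin.Subset using (Subset; inside; outside; ⊤; ⊥; ⁅_⁆; ⋃; _∪_; _-_)
open import Data.Fin.Subset.Properties
  using (∪-idem; ∪-identityˡ; ∪-identityʳ; ∪-assoc; ∪-commutativeMonoid)
open import Data.Integer as ℤ using (+_; -[1+_]; -≤+)
import Data.Integer.Properties as ℤ
open import Data.List using (List; []; _∷_; map; deduplicate; cartesianProductWith)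
open import Data.List.Membership.Propositional using () renaming (_∈_ to _∈ˡ_)
open import Data.List.Membership.Propositional.Properties
  using (∈-map⁺; ∈-map⁻; ∈-++⁺ˡ; ∈-++⁺ʳ; ∈-++⁻; ∈-deduplicate⁺; ∈-deduplicate⁻;
         ∈-cartesianProductWith⁺; ∈-cartesianProductWith⁻)
open import Data.List.Relation.Unary.Any using (here; there)
open import Data.List.Relation.Unary.Unique.DecPropositional.Properties using (deduplicate-!)
open import Data.Nat as ℕ using (ℕ; zero; suc; _≥_; z≤n; s≤s; _⊔_)
open import Data.Nat.Properties as ℕ using (m⊔n≤o⇒m≤o; m⊔n≤o⇒n≤o)
open import Data.Product using (Σ-syntax; ∃₂; _×_; _,_)
open import Data.Rational as ℚ using (ℚ; mkℚ; *≤*; 0ℚ; 1ℚ; ½; _/_)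
import Data.Rational.Properties as ℚ
open import Data.Rational.Unnormalised as ℚᵘ using (mkℚᵘ; *≡*)
import Data.Rational.Unnormalised.Properties as ℚᵘ
open import Data.Sum using (inj₁; inj₂)
open import Data.Vec using ([]; _∷_)
open import Data.Vec.Functional using (Vector) renaming ([] to []ᵛ; _∷_ to _∷ᵛ_)
open import Function using (_∘_; case_of_; mk⇔)
open import Level using (0ℓ)
open import Relation.Binary using (Rel; IsPreorder; IsEquivalence; Preorder)
open import Relation.Binary.PropositionalEquality
  using (_≡_; refl; sym; trans; cong; cong₂; subst; module ≡-Reasoning)
import Relation.Binary.Reasoning.Preorder as PreorderReasoning
import Relation.Binary.Reasoning.Setoid as SetoidReasoning
open import Relation.Nullary using (¬_)
open import Relation.Nullary.Decidable using (from-yes)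
open import Relation.Unary using (Empty)

-- Infeasibility certificates with natural multipliers

module ℕΣ = MonoidSum ℕ.+-0-monoid

-- The certificate argument uses only addition, natural multiples and a preorder compatible with
-- addition. Neither subtraction nor real multiplication enters, so the Cauchy reals need no further
-- structure.
module OrderedSums {c ℓ₁ ℓ₂} (M : CommutativeMonoid c ℓ₁)
  (_≤_ : Rel (CommutativeMonoid.Carrier M) ℓ₂)
  (≤-isPreorder : IsPreorder (CommutativeMonoid._≈_ M) _≤_)
  (+-mono : ∀ {w x y z} → w ≤ x → y ≤ z →
            CommutativeMonoid._∙_ M w y ≤ CommutativeMonoid._∙_ M x z) where

  open CommutativeMonoid M using (Carrier; _≈_; identityˡ; ∙-congˡ) renaming (_∙_ to _+_; ε to 0#)
  open CommutativeMonoidMult M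
    using (×-homo-+; ×-assocˡ; ×-distrib-+; ×-congʳ) renaming (_×_ to _•_)
  open CommutativeMonoidSum M
    using (sum-cong-≋; sum-replicate; sum-replicate-zero; ∑-distrib-+; ∑-comm) renaming (sum to ∑)
  open IsPreorder ≤-isPreorder using ()
    renaming (refl to ≤-refl; reflexive to ≤-reflexive; trans to ≤-trans)
  private
    preorder : Preorder c ℓ₁ ℓ₂
    preorder = record { isPreorder = ≤-isPreorder }
    module Eq = CommutativeMonoid M

  sum-mono : ∀ {n} {s t : Vector Carrier n} → (∀ i → s i ≤ t i) → ∑ s ≤ ∑ t
  sum-mono {zero}  s≤t = ≤-refl
  sum-mono {suc n} s≤t = +-mono (s≤t zero) (sum-mono (s≤t ∘ suc))

  •-monoʳ : ∀ k {x y} → x ≤ y → (k • x) ≤ (k • y)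
  •-monoʳ zero    x≤y = ≤-refl
  •-monoʳ (suc k) x≤y = +-mono x≤y (•-monoʳ k x≤y)

  •-monoˡ : ∀ {x} → 0# ≤ x → ∀ {j k} → j ℕ.≤ k → (j • x) ≤ (k • x)
  •-monoˡ 0≤x {k = zero}  z≤n       = ≤-refl
  •-monoˡ 0≤x {k = suc k} z≤n       =
    ≤-trans (≤-reflexive (Eq.sym (identityˡ 0#))) (+-mono 0≤x (•-monoˡ 0≤x {k = k} z≤n))
  •-monoˡ 0≤x             (s≤s j≤k) = +-mono ≤-refl (•-monoˡ 0≤x j≤k)

  •-distrib-sum : ∀ k {n} (t : Vector Carrier n) → (k • ∑ t) ≈ ∑ (λ i → k • t i)
  •-distrib-sum k {zero}  t = Eq.trans (Eq.sym (sum-replicate k)) (sum-replicate-zero k)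
  •-distrib-sum k {suc n} t = Eq.trans (×-distrib-+ (t zero) (∑ (t ∘ suc)) k)
                                       (∙-congˡ (•-distrib-sum k (t ∘ suc)))

  sum-distrib-• : ∀ {m} (k : Vector ℕ m) x → (ℕΣ.sum k • x) ≈ ∑ (λ i → k i • x)
  sum-distrib-• {zero}  k x = Eq.refl
  sum-distrib-• {suc m} k x = Eq.trans (×-homo-+ x (k zero) (ℕΣ.sum (k ∘ suc)))
                                       (∙-congˡ (sum-distrib-• (k ∘ suc) x))

  module _ {m n} (z : Vector ℕ m) (a : Fin m → Vector ℕ n) (b : Vector ℕ m) where

    combined : Vector ℕ n
    combined i = ℕΣ.sum λ k → z k ℕ.* a k i

    bound : ℕ
    bound = ℕΣ.sum λ k → z k ℕ.* b k

    -- Take `z k` copies of the `k`-th inequality, add them all, and exchange the two summations so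
    -- that the coefficients of each `y i` are collected.
    combine : ∀ {h} (y : Vector Carrier n) →
              (∀ k → (b k • h) ≤ ∑ (λ i → a k i • y i)) →
              (bound • h) ≤ ∑ (λ i → combined i • y i)
    combine {h} y b≤a = begin
      bound • h
        ≈⟨ sum-distrib-• (λ k → z k ℕ.* b k) h ⟩
      ∑ (λ k → (z k ℕ.* b k) • h)
        ≈⟨ sum-cong-≋ (λ k → ×-assocˡ h (z k) (b k)) ⟨
      ∑ (λ k → z k • b k • h)
        ∼⟨ sum-mono (λ k → •-monoʳ (z k) (b≤a k)) ⟩
      ∑ (λ k → z k • ∑ (λ i → a k i • y i))
        ≈⟨ sum-cong-≋ (λ k → •-distrib-sum (z k) (λ i → a k i • y i)) ⟩
      ∑ (λ k → ∑ (λ i → z k • a k i • y i))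
        ≈⟨ ∑-comm (λ k i → z k • a k i • y i) ⟩
      ∑ (λ i → ∑ (λ k → z k • a k i • y i))
        ≈⟨ sum-cong-≋ (λ i → sum-cong-≋ (λ k → ×-assocˡ (y i) (z k) (a k i))) ⟩
      ∑ (λ i → ∑ (λ k → (z k ℕ.* a k i) • y i))
        ≈⟨ sum-cong-≋ (λ i → sum-distrib-• (λ k → z k ℕ.* a k i) (y i)) ⟨
      ∑ (λ i → combined i • y i) ∎
      where open PreorderReasoning preorder

    -- Between natural numbers, `2c < b` means `1 + 2c ≤ b`. This spare unit in every coefficient
    -- absorbs one extra copy of `∑ y`, which is worth `u`. The contradiction is left as an
    -- inequality because a preordered monoid need not allow cancelling `bound • u`.
    infeasible : ∀ {h u} → (h + h) ≈ u →
                 (∀ i → combined i ℕ.+ combined i ℕ.< bound) →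
                 (y : Vector Carrier n) → (∀ i → 0# ≤ y i) → u ≤ ∑ y → ∑ y ≤ u →
                 (∀ k → (b k • h) ≤ ∑ (λ i → a k i • y i)) →
                 (u + bound • u) ≤ (bound • u)
    infeasible {h} {u} h+h≈u 2c<b y 0≤y u≤Σy Σy≤u b≤a = begin
      u + bound • u
        ≈⟨ ∙-congˡ (×-congʳ bound h+h≈u) ⟨
      u + bound • (h + h)
        ≈⟨ ∙-congˡ (×-distrib-+ h h bound) ⟩
      u + (bound • h + bound • h)
        ∼⟨ +-mono u≤Σy (+-mono (combine y b≤a) (combine y b≤a)) ⟩
      ∑ y + (∑ cy + ∑ cy)
        ≈⟨ ∙-congˡ (∑-distrib-+ cy cy) ⟨
      ∑ y + ∑ (λ i → cy i + cy i)
        ≈⟨ ∑-distrib-+ y (λ i → cy i + cy i) ⟨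
      ∑ (λ i → y i + (cy i + cy i))
        ≈⟨ sum-cong-≋ (λ i → ∙-congˡ (×-homo-+ (y i) (combined i) (combined i))) ⟨
      -- The strict inequality `2c<b` is by definition the bound on this successor.
      ∑ (λ i → suc (combined i ℕ.+ combined i) • y i)
        ∼⟨ sum-mono (λ i → •-monoˡ (0≤y i) (2c<b i)) ⟩
      ∑ (λ i → bound • y i)
        ≈⟨ •-distrib-sum bound y ⟨
      bound • ∑ y
        ∼⟨ •-monoʳ bound Σy≤u ⟩
      bound • u ∎
      where
      open PreorderReasoning preorder
      cy : Vector Carrier n
      cy i = combined i • y i

-- The Cauchy reals as a preordered commutative monoid

half-pos : ∀ {ε} → 0ℚ ℚ.< ε → 0ℚ ℚ.< ε ℚ.* ½
half-pos {ε} 0<ε = subst (ℚ._< ε ℚ.* ½) (ℚ.*-zeroˡ ½) (ℚ.*-monoˡ-<-pos ½ 0<ε)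

half+half : ∀ ε → ε ℚ.* ½ ℚ.+ ε ℚ.* ½ ≡ ε
half+half ε = trans (sym (ℚ.*-distribˡ-+ ε ½ ½)) (ℚ.*-identityʳ ε)

infix 4 _≗ᴿ_

-- Addition of reals acts termwise, so the monoid laws already hold for termwise equality, which is
-- finer than `_≈ᴿ_` and needs no estimates. Equalities of constant sequences can then be settled by
-- rational computation.
record _≗ᴿ_ (x y : ℝ) : Set where
  constructor pointwise
  field at-index : ∀ n → seq x n ≡ seq y n

open _≗ᴿ_

+ᴿ-commutativeMonoid : CommutativeMonoid 0ℓ 0ℓ
+ᴿ-commutativeMonoid = record
  { Carrier = ℝ
  ; _≈_     = _≗ᴿ_
  ; _∙_     = _+ᴿ_
  ; ε       = 0ᴿ
  ; isCommutativeMonoid = record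
    { isMonoid = record
      { isSemigroup = record
        { isMagma = record
          { isEquivalence = ≗ᴿ-isEquivalence
          ; ∙-cong = λ (pointwise p) (pointwise q) → pointwise λ n → cong₂ ℚ._+_ (p n) (q n)
          }
        ; assoc = λ x y z → pointwise λ n → ℚ.+-assoc (seq x n) (seq y n) (seq z n)
        }
      ; identity = (λ x → pointwise λ n → ℚ.+-identityˡ (seq x n))
                 , (λ x → pointwise λ n → ℚ.+-identityʳ (seq x n))
      }
    ; comm = λ x y → pointwise λ n → ℚ.+-comm (seq x n) (seq y n)
    }
  }
  where
  ≗ᴿ-isEquivalence : IsEquivalence _≗ᴿ_
  ≗ᴿ-isEquivalence = record
    { refl  = pointwise λ n → refl
    ; sym   = λ (pointwise p) → pointwise λ n → sym (p n)
    ; trans = λ (pointwise p) (pointwise q) → pointwise λ n → trans (p n) (q n)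
    }

p≤p+ε : ∀ p {ε} → 0ℚ ℚ.< ε → p ℚ.≤ p ℚ.+ ε
p≤p+ε p {ε} 0<ε =
  subst (ℚ._≤ p ℚ.+ ε) (ℚ.+-identityʳ p) (ℚ.+-monoʳ-≤ p (ℚ.<⇒≤ 0<ε))

-- _≤ᴿ_ unfolds to a Π-type from which x and y cannot be inferred; the record
-- keeps them visible to unification.
infix 4 _≤ʳ_

record _≤ʳ_ (x y : ℝ) : Set where
  constructor ⌊_⌋
  field below : x ≤ᴿ y

≗ᴿ⇒≤ʳ : ∀ {x y} → x ≗ᴿ y → x ≤ʳ y
≗ᴿ⇒≤ʳ {x} {y} x≗y = ⌊ (λ ε 0<ε → 0 , λ n _ →
  subst (ℚ._≤ seq y n ℚ.+ ε) (sym (at-index x≗y n)) (p≤p+ε (seq y n) 0<ε)) ⌋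

≤ʳ-trans : ∀ {x y z} → x ≤ʳ y → y ≤ʳ z → x ≤ʳ z
≤ʳ-trans {x} {y} {z} ⌊ x≤y ⌋ ⌊ y≤z ⌋ = ⌊ x≤z ⌋
  where
  x≤z : x ≤ᴿ z
  x≤z ε 0<ε with M , p ← x≤y (ε ℚ.* ½) (half-pos 0<ε)
               | N , q ← y≤z (ε ℚ.* ½) (half-pos 0<ε)
    = M ⊔ N , λ n le → begin
      seq x n                              ≤⟨ p n (m⊔n≤o⇒m≤o M N le) ⟩
      seq y n ℚ.+ ε ℚ.* ½                  ≤⟨ ℚ.+-monoˡ-≤ (ε ℚ.* ½) (q n (m⊔n≤o⇒n≤o M N le)) ⟩
      (seq z n ℚ.+ ε ℚ.* ½) ℚ.+ ε ℚ.* ½    ≡⟨ ℚ.+-assoc (seq z n) (ε ℚ.* ½) (ε ℚ.* ½) ⟩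
      seq z n ℚ.+ (ε ℚ.* ½ ℚ.+ ε ℚ.* ½)    ≡⟨ cong (seq z n ℚ.+_) (half+half ε) ⟩
      seq z n ℚ.+ ε                        ∎
    where open ℚ.≤-Reasoning

+ᴿ-mono-≤ʳ : ∀ {w x y z} → w ≤ʳ x → y ≤ʳ z → w +ᴿ y ≤ʳ x +ᴿ z
+ᴿ-mono-≤ʳ {w} {x} {y} {z} ⌊ w≤x ⌋ ⌊ y≤z ⌋ = ⌊ w+y≤x+z ⌋
  where
  w+y≤x+z : w +ᴿ y ≤ᴿ x +ᴿ z
  w+y≤x+z ε 0<ε with M , p ← w≤x (ε ℚ.* ½) (half-pos 0<ε)
                   | N , q ← y≤z (ε ℚ.* ½) (half-pos 0<ε)
    = M ⊔ N , λ n le → begin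
      seq w n ℚ.+ seq y n
        ≤⟨ ℚ.+-mono-≤ (p n (m⊔n≤o⇒m≤o M N le)) (q n (m⊔n≤o⇒n≤o M N le)) ⟩
      (seq x n ℚ.+ ε ℚ.* ½) ℚ.+ (seq z n ℚ.+ ε ℚ.* ½)
        ≡⟨ interchange (CommutativeMonoid.commutativeSemigroup ℚ.+-0-commutativeMonoid)
             (seq x n) (ε ℚ.* ½) (seq z n) (ε ℚ.* ½) ⟩
      (seq x n ℚ.+ seq z n) ℚ.+ (ε ℚ.* ½ ℚ.+ ε ℚ.* ½)
        ≡⟨ cong ((seq x n ℚ.+ seq z n) ℚ.+_) (half+half ε) ⟩
      (seq x n ℚ.+ seq z n) ℚ.+ ε ∎
    where open ℚ.≤-Reasoning

≤ʳ-isPreorder : IsPreorder _≗ᴿ_ _≤ʳ_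
≤ʳ-isPreorder = record
  { isEquivalence = CommutativeMonoid.isEquivalence +ᴿ-commutativeMonoid
  ; reflexive     = ≗ᴿ⇒≤ʳ
  ; trans         = ≤ʳ-trans
  }

≤ʳ-preorder : Preorder 0ℓ 0ℓ 0ℓ
≤ʳ-preorder = record { isPreorder = ≤ʳ-isPreorder }

p≤∣p∣ : ∀ p → p ℚ.≤ ℚ.∣ p ∣
p≤∣p∣ (mkℚ (+ _)      _ _) = ℚ.≤-refl
p≤∣p∣ (mkℚ (-[1+ _ ]) _ _) = *≤* -≤+

≈ᴿ⇒≤ʳ : ∀ {x y} → x ≈ᴿ y → x ≤ʳ y
≈ᴿ⇒≤ʳ {x} {y} x≈y = ⌊ (λ ε 0<ε → let N , p = x≈y ε 0<ε in N , λ n le → begin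
  seq x n
    ≡⟨ xyx⁻¹≈y ℚ.+-0-abelianGroup (seq y n) (seq x n) ⟨
  seq y n ℚ.+ seq x n ℚ.- seq y n
    ≡⟨ ℚ.+-assoc (seq y n) (seq x n) (ℚ.- seq y n) ⟩
  seq y n ℚ.+ (seq x n ℚ.- seq y n)
    ≤⟨ ℚ.+-monoʳ-≤ (seq y n) (ℚ.≤-trans (p≤∣p∣ (seq x n ℚ.- seq y n)) (p n le)) ⟩
  seq y n ℚ.+ ε ∎) ⌋
  where open ℚ.≤-Reasoning

≈ᴿ-sym : ∀ {x y} → x ≈ᴿ y → y ≈ᴿ x
≈ᴿ-sym {x} {y} x≈y ε 0<ε = let N , p = x≈y ε 0<ε in N , λ n le → begin
  ℚ.∣ seq y n ℚ.- seq x n ∣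
    ≡⟨ cong ℚ.∣_∣ (⁻¹-anti-homo-// ℚ.+-0-group (seq x n) (seq y n)) ⟨
  ℚ.∣ ℚ.- (seq x n ℚ.- seq y n) ∣
    ≡⟨ ℚ.∣-p∣≡∣p∣ (seq x n ℚ.- seq y n) ⟩
  ℚ.∣ seq x n ℚ.- seq y n ∣
    ≤⟨ p n le ⟩
  ε ∎
  where open ℚ.≤-Reasoning

≗ᴿ⇒≈ᴿ : ∀ {x y} → x ≗ᴿ y → x ≈ᴿ y
≗ᴿ⇒≈ᴿ {x} {y} x≗y ε 0<ε = 0 , λ n _ → subst (ℚ._≤ ε) (sym (begin
  ℚ.∣ seq x n ℚ.- seq y n ∣  ≡⟨ cong (λ p → ℚ.∣ p ℚ.- seq y n ∣) (at-index x≗y n) ⟩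
  ℚ.∣ seq y n ℚ.- seq y n ∣  ≡⟨ cong ℚ.∣_∣ (ℚ.+-inverseʳ (seq y n)) ⟩
  0ℚ                         ∎)) (ℚ.<⇒≤ 0<ε)
  where open ≡-Reasoning

1+x≰x : ∀ {x} → ¬ (1ᴿ +ᴿ x ≤ʳ x)
-- Any tolerance below 1 refutes the inequality at a single index; `½` is taken.
1+x≰x {x} ⌊ 1+x≤x ⌋ = let N , p = 1+x≤x ½ (from-yes (0ℚ ℚ.<? ½)) in
  ℚ.<-irrefl refl (ℚ.<-≤-trans
    (subst (seq x N ℚ.+ ½ ℚ.<_) (ℚ.+-comm (seq x N) 1ℚ)
      (ℚ.+-monoʳ-< (seq x N) (from-yes (½ ℚ.<? 1ℚ))))
    (p N ℕ.≤-refl))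

-- Half-cardinalities as natural multiples of one half

-- For a variable `c` the reduction of `+ c / 2` to lowest terms is stuck, so the identity is
-- checked by cross-multiplication of unnormalised fractions. There `mkℚᵘ` takes the denominator
-- minus one, hence the argument 1 for halves.
/2-suc : ∀ c → + suc c / 2 ≡ ½ ℚ.+ + c / 2
/2-suc c = ℚ.toℚᵘ-injective (begin
  ℚ.toℚᵘ (+ suc c / 2)               ≈⟨ ℚ.toℚᵘ-fromℚᵘ (mkℚᵘ (+ suc c) 1) ⟩
  mkℚᵘ (+ suc c) 1                   ≈⟨ *≡* (halves c) ⟩
  mkℚᵘ (+ 1) 1 ℚᵘ.+ mkℚᵘ (+ c) 1     ≈⟨ ℚᵘ.+-congʳ (mkℚᵘ (+ 1) 1) (ℚ.toℚᵘ-fromℚᵘ (mkℚᵘ (+ c) 1)) ⟨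
  mkℚᵘ (+ 1) 1 ℚᵘ.+ ℚ.toℚᵘ (+ c / 2) ≈⟨ ℚ.toℚᵘ-homo-+ ½ (+ c / 2) ⟨
  ℚ.toℚᵘ (½ ℚ.+ + c / 2)             ∎)
  where
  open SetoidReasoning ℚᵘ.≃-setoid
  halves : ∀ c → + suc c ℤ.* + 4 ≡ (+ 2 ℤ.+ + c ℤ.* + 2) ℤ.* + 2
  halves c = trans (sym (ℤ.*-assoc (+ suc c) (+ 2) (+ 2)))
                   (cong (ℤ._* + 2) (ℤ.*-distribʳ-+ (+ 2) (+ 1) (+ c)))

open CommutativeMonoidMult +ᴿ-commutativeMonoid using () renaming (_×_ to _•_)
open CommutativeMonoidSum +ᴿ-commutativeMonoid using (sum-cong-≋)

-- _·_ and _•_ are the same recursion over raw monoids with different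
-- equalities, hence not definitionally equal.
·≗• : ∀ k x → k · x ≗ᴿ k • x
·≗• zero    x = pointwise λ _ → refl
·≗• (suc k) x = CommutativeMonoid.∙-congˡ +ᴿ-commutativeMonoid {x} (·≗• k x)

half≗ : ∀ c → c • fromℚ ½ ≗ᴿ fromℚ (+ c / 2)
half≗ zero    = pointwise λ _ → refl
half≗ (suc c) = pointwise λ n →
  trans (cong (½ ℚ.+_) (at-index (half≗ c) n)) (sym (/2-suc c))

-- Union-closed families containing the empty set

record IsPointedUC {n} (F : Family n) : Set where
  field
    ⊥∈     : ⊥ ∈ᶠ F
    closed : ∀ {S T} → S ∈ᶠ F → T ∈ᶠ F → S ∪ T ∈ᶠ F

  isUC : IsUC F
  isUC = record
    { nonempty = λ ≡[] → case subst (⊥ ∈ˡ_) ≡[] ⊥∈ of λ ()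
    ; closed   = closed
    }

open IsPointedUC

module _ {n} (F G : Family n) where

  ∈-⊎⁺ : ∀ {S T} → S ∈ᶠ F → T ∈ᶠ G → S ∪ T ∈ᶠ F ⊎ G
  ∈-⊎⁺ S∈F T∈G = ∈-deduplicate⁺ _≟ˢ_ (∈-cartesianProductWith⁺ _∪_ S∈F T∈G)

  ∈-⊎⁻ : ∀ {S} → S ∈ᶠ F ⊎ G → ∃₂ λ T U → T ∈ᶠ F × U ∈ᶠ G × S ≡ T ∪ U
  ∈-⊎⁻ S∈ = ∈-cartesianProductWith⁻ _∪_ (sets F) (sets G)
             (∈-deduplicate⁻ _≟ˢ_ (cartesianProductWith _∪_ (sets F) (sets G)) S∈)

  -- Regroup `(P ∪ Q) ∪ (R ∪ U)` as `(P ∪ R) ∪ (Q ∪ U)`.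
  ⊎-isPointedUC : IsPointedUC F → IsPointedUC G → IsPointedUC (F ⊎ G)
  ⊥∈     (⊎-isPointedUC f g) = subst (_∈ᶠ F ⊎ G) (∪-identityˡ ⊥) (∈-⊎⁺ (⊥∈ f) (⊥∈ g))
  closed (⊎-isPointedUC f g) {S} {T} S∈ T∈
    with P , Q , P∈ , Q∈ , refl ← ∈-⊎⁻ S∈
       | R , U , R∈ , U∈ , refl ← ∈-⊎⁻ T∈
    = subst (_∈ᶠ F ⊎ G)
        (interchange (CommutativeMonoid.commutativeSemigroup (∪-commutativeMonoid n)) P R Q U)
        (∈-⊎⁺ (closed f P∈ R∈) (closed g Q∈ U∈))

-- Closure of `A` under union gives one inclusion and `⊥ ∈ᶠ A` the other. Hence every `F ⊎ A` meets
-- the absorption condition on the families tested by `Polyhedron A`.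
⊎-absorb : ∀ {n} (F A : Family n) → IsPointedUC A → (F ⊎ A) ⊎ A ≐ F ⊎ A
⊎-absorb F A a {S} = mk⇔ absorb extend
  where
  absorb : S ∈ᶠ (F ⊎ A) ⊎ A → S ∈ᶠ F ⊎ A
  absorb S∈ with R , V , R∈ , V∈ , refl ← ∈-⊎⁻ (F ⊎ A) A S∈
            with T , U , T∈ , U∈ , refl ← ∈-⊎⁻ F A R∈
    = subst (_∈ᶠ F ⊎ A) (sym (∪-assoc T U V)) (∈-⊎⁺ F A T∈ (closed a U∈ V∈))
  extend : S ∈ᶠ F ⊎ A → S ∈ᶠ (F ⊎ A) ⊎ A
  extend S∈ = subst (_∈ᶠ (F ⊎ A) ⊎ A) (∪-identityʳ S) (∈-⊎⁺ (F ⊎ A) A S∈ (⊥∈ a))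

𝒫-isPointedUC : ∀ {n} (S : Subset n) → IsPointedUC (𝒫 S)
⊥∈ (𝒫-isPointedUC [])            = here refl
⊥∈ (𝒫-isPointedUC (outside ∷ S)) = ∈-map⁺ _ (⊥∈ (𝒫-isPointedUC S))
⊥∈ (𝒫-isPointedUC (inside  ∷ S)) = ∈-++⁺ˡ (∈-map⁺ _ (⊥∈ (𝒫-isPointedUC S)))
closed (𝒫-isPointedUC []) {[]} {[]} _ _ = here refl
closed (𝒫-isPointedUC (outside ∷ S)) T∈ U∈
  with _ , T∈′ , refl ← ∈-map⁻ _ T∈ | _ , U∈′ , refl ← ∈-map⁻ _ U∈
  = ∈-map⁺ _ (closed (𝒫-isPointedUC S) T∈′ U∈′)
closed (𝒫-isPointedUC (inside ∷ S)) T∈ U∈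
  with ∈-++⁻ (map (outside ∷_) (subsets S)) T∈ | ∈-++⁻ (map (outside ∷_) (subsets S)) U∈
-- The union avoids the first element only if both arguments do; the other three cases land in the
-- second half of the list.
... | inj₁ p | inj₁ q with _ , p′ , refl ← ∈-map⁻ _ p | _ , q′ , refl ← ∈-map⁻ _ q
  = ∈-++⁺ˡ (∈-map⁺ _ (closed (𝒫-isPointedUC S) p′ q′))
... | inj₁ p | inj₂ q with _ , p′ , refl ← ∈-map⁻ _ p | _ , q′ , refl ← ∈-map⁻ _ q
  = ∈-++⁺ʳ _ (∈-map⁺ _ (closed (𝒫-isPointedUC S) p′ q′))
... | inj₂ p | inj₁ q with _ , p′ , refl ← ∈-map⁻ _ p | _ , q′ , refl ← ∈-map⁻ _ q
  = ∈-++⁺ʳ _ (∈-map⁺ _ (closed (𝒫-isPointedUC S) p′ q′))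
... | inj₂ p | inj₂ q with _ , p′ , refl ← ∈-map⁻ _ p | _ , q′ , refl ← ∈-map⁻ _ q
  = ∈-++⁺ʳ _ (∈-map⁺ _ (closed (𝒫-isPointedUC S) p′ q′))

-- Deduplication covers the case that `S` is itself empty.
pair : ∀ {n} → Subset n → Family n
pair S = mkFamily (deduplicate _≟ˢ_ (⊥ ∷ S ∷ [])) (deduplicate-! _≟ˢ_ (⊥ ∷ S ∷ []))

pair-isPointedUC : ∀ {n} (S : Subset n) → IsPointedUC (pair S)
⊥∈     (pair-isPointedUC S) = ∈-deduplicate⁺ _≟ˢ_ {⊥ ∷ S ∷ []} (here refl)
closed (pair-isPointedUC S) T∈ U∈ =
  ∈-deduplicate⁺ _≟ˢ_ (go (∈-deduplicate⁻ _≟ˢ_ _ T∈) (∈-deduplicate⁻ _≟ˢ_ _ U∈))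
  where
  go : ∀ {T U} → T ∈ˡ ⊥ ∷ S ∷ [] → U ∈ˡ ⊥ ∷ S ∷ [] → T ∪ U ∈ˡ ⊥ ∷ S ∷ []
  go (here refl)         (here refl)         = here (∪-identityˡ ⊥)
  go (here refl)         (there (here refl)) = there (here (∪-identityˡ S))
  go (there (here refl)) (here refl)         = there (here (∪-identityʳ S))
  go (there (here refl)) (there (here refl)) = there (here (∪-idem S))

-- The union-closed family generated by the listed sets together with the empty set: each `pair`
-- offers the choice of including its generator in the union or not.
⟨_⟩ : ∀ {n} → List (Subset n) → Family n
⟨ []     ⟩ = 𝒫 ⊥
⟨ S ∷ Ss ⟩ = pair S ⊎ ⟨ Ss ⟩

⟨⟩-isPointedUC : ∀ {n} (Ss : List (Subset n)) → IsPointedUC ⟨ Ss ⟩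
⟨⟩-isPointedUC []       = 𝒫-isPointedUC ⊥
⟨⟩-isPointedUC (S ∷ Ss) = ⊎-isPointedUC (pair S) ⟨ Ss ⟩ (pair-isPointedUC S) (⟨⟩-isPointedUC Ss)

-- Emptiness of the polyhedron from a counting condition

module ℝΣ = OrderedSums +ᴿ-commutativeMonoid _≤ʳ_ ≤ʳ-isPreorder +ᴿ-mono-≤ʳ

module _ {m n} (z : Vector ℕ m) (F : Vector (Family n) m) (A : Family n) where

  memberships : Fin n → ℕ
  memberships = ℝΣ.combined z (λ k i → card ((F k ⊎ A) at i)) (λ k → card (F k ⊎ A))

  members : ℕ
  members = ℝΣ.bound z (λ k i → card ((F k ⊎ A) at i)) (λ k → card (F k ⊎ A))

  -- If every element lies in fewer than half of the sets, counted with multiplicities `z`, then so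
  -- does every weighted average of elements, against the sum of the `heavy` inequalities.
  polyhedron-empty : IsPointedUC A → (∀ k → IsPointedUC (F k)) →
                     (∀ i → memberships i ℕ.+ memberships i ℕ.< members) →
                     Empty (Polyhedron A)
  -- With `h` equal to one half and `u` to 1, infeasibility reads `1 + x ≤ x`, where `x` is
  -- `members` copies of 1.
  polyhedron-empty a f 2c<b y P = 1+x≰x
    (ℝΣ.infeasible z (λ k i → card ((F k ⊎ A) at i)) (λ k → card (F k ⊎ A))
      {fromℚ ½} {1ᴿ} (pointwise λ _ → refl) 2c<b y
      (λ i → ⌊ nonneg i ⌋) (≈ᴿ⇒≤ʳ (≈ᴿ-sym {sum y} {1ᴿ} total)) (≈ᴿ⇒≤ʳ total)
      (λ k → heavy′ (F k ⊎ A) (isUC (⊎-isPointedUC (F k) A (f k) a)) (⊎-absorb (F k) A a)))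
    where
    open Polyhedron P
    heavy′ : ∀ B → IsUC B → B ⊎ A ≐ B → card B • fromℚ ½ ≤ʳ sum (λ i → card (B at i) • y i)
    heavy′ B uc ⊎A = begin
      card B • fromℚ ½                ≈⟨ half≗ (card B) ⟩
      half-card B                     ∼⟨ ⌊ heavy B uc ⊎A ⌋ ⟩
      weight y B                      ≈⟨ sum-cong-≋ (λ i → ·≗• (card (B at i)) (y i)) ⟩
      sum (λ i → card (B at i) • y i) ∎
      where open PreorderReasoning ≤ʳ-preorder

-- The counterexample on six elements

⟪_⟫ : ∀ {n} → List (Fin n) → Subset n
⟪ is ⟫ = ⋃ (map ⁅_⁆ is)

generators : List (Subset 6)
generators
  = ⟪ 0F ∷ 1F ∷ 2F ∷ [] ⟫
  ∷ ⟪ 0F ∷ 1F ∷ 2F ∷ 3F ∷ [] ⟫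
  ∷ ⟪ 0F ∷ 1F ∷ 2F ∷ 4F ∷ 5F ∷ [] ⟫
  ∷ ⟪ 0F ∷ 3F ∷ 4F ∷ 5F ∷ [] ⟫
  ∷ ⟪ 1F ∷ 3F ∷ 4F ∷ 5F ∷ [] ⟫
  ∷ ⟪ 2F ∷ 3F ∷ 4F ∷ 5F ∷ [] ⟫
  ∷ []

𝒜 : Family 6
𝒜 = ⟨ generators ⟩

𝒜-isPointedUC : IsPointedUC 𝒜
𝒜-isPointedUC = ⟨⟩-isPointedUC generators

-- Permuting {0,1,2} or {4,5} preserves 𝒜, hence the repeated entries.
q : Vector ℚ 6
q = + 5572 / 29932 ∷ᵛ + 5572 / 29932 ∷ᵛ + 5572 / 29932 ∷ᵛ
    + 5196 / 29932 ∷ᵛ + 4003 / 29932 ∷ᵛ + 4003 / 29932 ∷ᵛ []ᵛ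

0≤q : ∀ i → 0ℚ ℚ.≤ q i
0≤q = from-yes (all? λ i → 0ℚ ℚ.≤? q i)

q-tight : ∀ j → weight (fromℚ ∘ q) (𝒫 (⊤ - j) ⊎ 𝒜) ≗ᴿ half-card (𝒫 (⊤ - j) ⊎ 𝒜)
-- All sequences here are constant, so the variable index `n` does not block evaluation, and the six
-- equations are decided as equalities of rationals.
q-tight j = pointwise λ n → from-yes (all? λ j →
  seq (weight (fromℚ ∘ q) (𝒫 (⊤ - j) ⊎ 𝒜)) n ℚ.≟ seq (half-card (𝒫 (⊤ - j) ⊎ 𝒜)) n) j

-- These are the families before joining with `𝒜`, which `polyhedron-empty` does itself; the last
-- one then becomes the family `𝒢`.
ℱ : Vector (Family 6) 5
ℱ = 𝒫 (⊤ - 0F) ∷ᵛ 𝒫 (⊤ - 1F) ∷ᵛ 𝒫 (⊤ - 2F) ∷ᵛ 𝒫 (⊤ - 3F)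
  ∷ᵛ (𝒫 ⟪ 0F ∷ 1F ∷ 2F ∷ 3F ∷ [] ⟫ ⊎ ⟨ ⟪ 3F ∷ 4F ∷ 5F ∷ [] ⟫ ∷ [] ⟩) ∷ᵛ []ᵛ

-- The dual certificate: these multiplicities make the combined membership count of every element
-- fall below half.
z : Vector ℕ 5
z = 7 ∷ᵛ 7 ∷ᵛ 7 ∷ᵛ 8 ∷ᵛ 16 ∷ᵛ []ᵛ

ℱ-isPointedUC : ∀ k → IsPointedUC (ℱ k)
ℱ-isPointedUC 0F = 𝒫-isPointedUC (⊤ - 0F)
ℱ-isPointedUC 1F = 𝒫-isPointedUC (⊤ - 1F)
ℱ-isPointedUC 2F = 𝒫-isPointedUC (⊤ - 2F)
ℱ-isPointedUC 3F = 𝒫-isPointedUC (⊤ - 3F)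
ℱ-isPointedUC 4F = ⊎-isPointedUC (𝒫 ⟪ 0F ∷ 1F ∷ 2F ∷ 3F ∷ [] ⟫) ⟨ ⟪ 3F ∷ 4F ∷ 5F ∷ [] ⟫ ∷ [] ⟩
  (𝒫-isPointedUC ⟪ 0F ∷ 1F ∷ 2F ∷ 3F ∷ [] ⟫) (⟨⟩-isPointedUC (⟪ 3F ∷ 4F ∷ 5F ∷ [] ⟫ ∷ []))

average-membership<½ : ∀ i → memberships z ℱ 𝒜 i ℕ.+ memberships z ℱ 𝒜 i ℕ.< members z ℱ 𝒜
average-membership<½ =
  from-yes (all? λ i → memberships z ℱ 𝒜 i ℕ.+ memberships z ℱ 𝒜 i ℕ.<? members z ℱ 𝒜)

corollary7 : Σ[ n ∈ ℕ ] n ≥ 1 × (Σ[ A ∈ Family n ]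
    IsUC A × ⋃ (sets A) ≡ ⊤ × ⊥ ∈ᶠ A ×
    (Σ[ y ∈ Vector ℝ n ]
    (∀ i → y i ≥ᴿ 0ᴿ) ×
    sum y ≤ᴿ 1ᴿ ×
    (∀ (j : Fin n) → weight y (𝒫 (⊤ - j) ⊎ A) ≈ᴿ half-card (𝒫 (⊤ - j) ⊎ A))) ×
    Empty (Polyhedron A))
corollary7 =
  -- The `refl` has the union of all members of `𝒜` evaluated to the whole ground set.
  6 , s≤s z≤n , 𝒜 , isUC 𝒜-isPointedUC , refl , ⊥∈ 𝒜-isPointedUC ,
  (fromℚ ∘ q , q≥0 , Σq≤1 , λ j → ≗ᴿ⇒≈ᴿ (q-tight j)) ,
  polyhedron-empty z ℱ 𝒜 𝒜-isPointedUC ℱ-isPointedUC average-membership<½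
  where
  q≥0 : ∀ i → fromℚ (q i) ≥ᴿ 0ᴿ
  q≥0 i ε 0<ε = 0 , λ _ _ → ℚ.≤-trans (0≤q i) (p≤p+ε (q i) 0<ε)

  Σq≤1 : sum (fromℚ ∘ q) ≤ᴿ 1ᴿ
  Σq≤1 ε 0<ε = 0 , λ n _ →
    ℚ.≤-trans (from-yes (seq (sum (fromℚ ∘ q)) n ℚ.≤? 1ℚ)) (p≤p+ε 1ℚ 0<ε)
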